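{- Let $G$ be a finite undirected graph with at least one vertex, let $\tilde{G}$ be its maximum independent set graph, and let $\mathbf{V}^*=(V_1,\dots,V_n)$ be an optimal sum coloring of $G$ (an optimal solution of the Minimum Sum Coloring Problem on $G$). Then $\mathbf{V}^*$ has at most $\alpha(\tilde{G})$ color classes of size $\alpha(G)$: $$|\{V_i\in\mathbf{V}^* : |V_i|=\alpha(G)\}|\le\alpha(\tilde{G}).$$
   Context: For a graph $H$, $\alpha(H)$ denotes the maximum size of an independent set of $H$. A (proper) coloring of $G=(V,E)$ with $|V|=n$ is a tuple $\mathbf{V}=(V_1,\dots,V_n)$ of pairwise disjoint, possibly empty subsets of $V$ (color classes) with union $V$, such that no $V_l$ contains both endpoints of an edge, and with $|V_l|\ge|V_{l+1}|$ for $l=1,\dots,n-1$. The Minimum Sum Coloring Problem is to minimize $f_\Sigma(\mathbf{V})=\sum_{l=1}^n l\,|V_l|$ over all such colorings; a minimizer is called an optimal sum coloring. The maximum independent set graph $\tilde{G}=(\tilde{V},\tilde{E})$ of $G$ is defined as follows: the vertices of $\tilde{G}$ are the maximum independent sets of $G$ (independent sets of size $\alpha(G)$), and two distinct vertices $u,v\in\tilde{V}$ are adjacent if and only if $u\cap v\neq\emptyset$. -}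

module Defs where

import Algebra.Properties.CommutativeMonoid.Sum as Sum
open import Data.Bool.Base using (true; false)
open import Data.Fin.Base using (Fin; toℕ)
open import Data.Fin.Properties using (all?) renaming (_≟_ to _≟ᶠ_)
open import Data.Fin.Subset using (Subset; _∈_; _∩_; ∣_∣; Nonempty; Empty; ⊥)
open import Data.Fin.Subset.Properties using (_∈?_; nonempty?; ∩-comm; ∉⊥; ∣⊥∣≡0)
open import Data.List.Base as List
  using (List; []; _∷_; map; filter; length; lookup; cartesianProductWith)
open import Data.List.Extrema.Nat using (max; xs≤max; argmax-sel)
open import Data.List.Membership.Propositional using () renaming (_∈_ to _∈ˡ_)
open import Data.List.Membership.Propositional.Properties
  using (∈-filter⁺; ∈-filter⁻; ∈-map⁺; ∈-map⁻; ∈-cartesianProductWith⁺)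
open import Data.List.Relation.Unary.All as All using ([]; _∷_)
open import Data.List.Relation.Unary.AllPairs using ([]; _∷_)
open import Data.List.Relation.Unary.Any using (here; there)
open import Data.List.Relation.Unary.Unique.Propositional using (Unique)
import Data.List.Relation.Unary.Unique.Propositional.Properties as Unique
open import Data.Nat.Base using (ℕ; zero; suc; _*_; _≤_)
open import Data.Nat.Properties using (+-0-commutativeMonoid) renaming (_≟_ to _≟ⁿ_)
open import Data.Product.Base using (∃; _×_; _,_; proj₂)
open import Data.Sum.Base using (inj₁; inj₂)
open import Data.Vec.Base using ([]; _∷_)
open import Data.Vec.Functional using (Vector)
open import Data.Vec.Properties using (∷-injective)
open import Function.Base using (_∘_; id)
open import Level using (0ℓ)
open import Relation.Binary.Core using (Rel)
open import Relation.Binary.Definitions using (Decidable; Symmetric; Irreflexive)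
open import Relation.Binary.PropositionalEquality using (_≡_; _≢_; refl; sym; subst; trans)
open import Relation.Nullary using (¬_; ¬?; _×-dec_; _→-dec_; contradiction)
open import Relation.Unary as U using ()

open Sum +-0-commutativeMonoid using (sum; sum-syntax)

record Graph : Set₁ where
  infix 4 _~_ _~?_
  field
    order    : ℕ
    _~_      : Rel (Fin order) 0ℓ
    _~?_     : Decidable _~_
    ~-sym    : Symmetric _~_
    ~-irrefl : Irreflexive _≡_ _~_

subsets : ∀ n → List (Subset n)
subsets zero    = [] ∷ []
subsets (suc n) = cartesianProductWith _∷_ (true ∷ false ∷ []) (subsets n)

∈-subsets : ∀ {n} (S : Subset n) → S ∈ˡ subsets n
∈-subsets []          = here refl
∈-subsets (true  ∷ S) =
  ∈-cartesianProductWith⁺ _∷_ {xs = true ∷ false ∷ []} (here refl) (∈-subsets S)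
∈-subsets (false ∷ S) =
  ∈-cartesianProductWith⁺ _∷_ {xs = true ∷ false ∷ []} (there (here refl)) (∈-subsets S)

subsets-unique : ∀ n → Unique (subsets n)
subsets-unique zero    = [] ∷ []
subsets-unique (suc n) =
  Unique.cartesianProductWith⁺ _∷_ ∷-injective (((λ ()) ∷ []) ∷ [] ∷ []) (subsets-unique n)

module _ (G : Graph) where
  open Graph G

  IsIndependent : Subset order → Set
  IsIndependent S = ∀ u v → u ∈ S → v ∈ S → ¬ (u ~ v)

  isIndependent? : U.Decidable IsIndependent
  isIndependent? S =
    all? λ u → all? λ v → (u ∈? S) →-dec ((v ∈? S) →-dec ¬? (u ~? v))

  independentSets : List (Subset order)
  independentSets = filter isIndependent? (subsets order)

  -- The default 0 is the size of the empty set, which is independent;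
  -- see α-attained.
  α : ℕ
  α = max 0 (map ∣_∣ independentSets)

  ∣independent∣≤α : ∀ {S} → IsIndependent S → ∣ S ∣ ≤ α
  ∣independent∣≤α {S} ind = All.lookup (xs≤max 0 (map ∣_∣ independentSets))
    (∈-map⁺ ∣_∣ (∈-filter⁺ isIndependent? (∈-subsets S) ind))

  α-attained : ∃ λ S → IsIndependent S × ∣ S ∣ ≡ α
  α-attained with argmax-sel id 0 (map ∣_∣ independentSets)
  ... | inj₁ α≡0 = ⊥ , (λ _ _ u∈⊥ → contradiction u∈⊥ ∉⊥) , trans (∣⊥∣≡0 order) (sym α≡0)
  ... | inj₂ α∈ with S , S∈ , α≡∣S∣ ← ∈-map⁻ ∣_∣ α∈ =
    S , proj₂ (∈-filter⁻ isIndependent? {xs = subsets order} S∈) , sym α≡∣S∣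

  IsMaximumIndependent : Subset order → Set
  IsMaximumIndependent S = IsIndependent S × ∣ S ∣ ≡ α

  isMaximumIndependent? : U.Decidable IsMaximumIndependent
  isMaximumIndependent? S = isIndependent? S ×-dec (∣ S ∣ ≟ⁿ α)

  maximumIndependentSets : List (Subset order)
  maximumIndependentSets = filter isMaximumIndependent? (subsets order)

  ∈-maximumIndependentSets⁺ : ∀ {S} → IsMaximumIndependent S → S ∈ˡ maximumIndependentSets
  ∈-maximumIndependentSets⁺ {S} = ∈-filter⁺ isMaximumIndependent? (∈-subsets S)

  ∈-maximumIndependentSets⁻ : ∀ {S} → S ∈ˡ maximumIndependentSets → IsMaximumIndependent S
  ∈-maximumIndependentSets⁻ = proj₂ ∘ ∈-filter⁻ isMaximumIndependent? {xs = subsets order}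

  maximumIndependentSets-unique : Unique maximumIndependentSets
  maximumIndependentSets-unique = Unique.filter⁺ isMaximumIndependent? (subsets-unique order)

  -- Vertices are positions in maximumIndependentSets; that list has no
  -- duplicates, so distinct positions are distinct sets.
  maximumIndependentSetGraph : Graph
  maximumIndependentSetGraph = record
    { order    = length maximumIndependentSets
    ; _~_      = λ u v → u ≢ v × Nonempty (set u ∩ set v)
    ; _~?_     = λ u v → ¬? (u ≟ᶠ v) ×-dec nonempty? (set u ∩ set v)
    ; ~-sym    = λ {u} {v} (u≢v , ne) → u≢v ∘ sym , subst Nonempty (∩-comm (set u) (set v)) ne
    ; ~-irrefl = λ u≡v (u≢v , _) → u≢v u≡v
    }
    where
    set : Fin (length maximumIndependentSets) → Subset order
    set = lookup maximumIndependentSets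

  record IsColoring (V : Vector (Subset order) order) : Set where
    field
      disjoint : ∀ k l → k ≢ l → Empty (V k ∩ V l)
      covering : ∀ x → ∃ λ l → x ∈ V l
      proper   : ∀ l → IsIndependent (V l)
      sorted   : ∀ k l → toℕ l ≡ suc (toℕ k) → ∣ V l ∣ ≤ ∣ V k ∣

  -- Classes are indexed from 0, so class l has weight suc (toℕ l).
  fΣ : Vector (Subset order) order → ℕ
  fΣ V = ∑[ l < order ] (suc (toℕ l) * ∣ V l ∣)

  record IsOptimalSumColoring (V : Vector (Subset order) order) : Set where
    field
      isColoring : IsColoring V
      minimal    : ∀ W → IsColoring W → fΣ V ≤ fΣ W

  maximumClasses : Vector (Subset order) order → List (Subset order)
  maximumClasses V = filter (λ S → ∣ S ∣ ≟ⁿ α) (List.tabulate V)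

{-# OPTIONS --safe #-}

-- The classes of size α(G) are maximum independent sets, hence vertices of the
-- maximum independent set graph. They are pairwise disjoint, so no two of them
-- are adjacent there, and they are distinct because α(G) > 0 makes them nonempty.

module Submission where

open import Defs
open import Data.Nat.Base using (ℕ; _≤_; _<_; z≤n; s≤s)
open import Data.List.Base using (List; []; _∷_; length; lookup; tabulate)
open import Data.Fin.Subset using (Subset; _∈_; _∩_; _-_; ∣_∣; Nonempty; Empty; ⁅_⁆)
open import Data.Vec.Functional using (Vector)

open import Data.Bool.Properties using () renaming (_≟_ to _≟ᵇ_)
open import Data.Fin.Base using (Fin; zero; suc; fromℕ<)
open import Data.Fin.Properties using (any?) renaming (_≟_ to _≟ᶠ_)
open import Data.Fin.Subset.Properties
  using (Empty-unique; ∣⊥∣≡0; ∩-idem; ∣⁅x⁆∣≡1; x∈⁅y⁆⇒x≡y; x∈p∧x≢y⇒x∈p-y; x∈p⇒∣p-x∣<∣p∣)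
open import Data.List.Membership.Propositional using () renaming (_∈_ to _∈ˡ_)
open import Data.List.Membership.Propositional.Properties
  using (∈-filter⁻; ∈-tabulate⁻; ∈-lookup)
open import Data.List.Relation.Unary.All as All using (All; []; _∷_)
import Data.List.Relation.Unary.All.Properties as All
open import Data.List.Relation.Unary.AllPairs using (AllPairs; []; _∷_)
import Data.List.Relation.Unary.AllPairs.Properties as AllPairs
open import Data.List.Relation.Unary.Any using (index)
open import Data.List.Relation.Unary.Any.Properties using (lookup-index)
open import Data.List.Relation.Unary.Unique.Propositional using (Unique)
open import Data.Nat.Properties using (≤-trans; <-irrefl) renaming (_≟_ to _≟ⁿ_)
open import Data.Product.Base using (∃; _×_; _,_)
import Data.Vec.Base as Vec
open import Data.Vec.Properties using (≡-dec; lookup∘tabulate; lookup⇒[]=; []=⇒lookup)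
open import Function.Base using (_∘_)
open import Level using (Level)
open import Relation.Binary.PropositionalEquality using (_≡_; _≢_; refl; sym; trans; cong; cong₂; subst)
open import Relation.Nullary using (does; yes; no; contradiction)
open import Relation.Nullary.Decidable using (dec-true)
open import Relation.Unary using (Pred; Decidable)

private
  variable
    a p : Level
    A : Set a
    n : ℕ

lookup-injective : {xs : List A} → Unique xs → ∀ i j → lookup xs i ≡ lookup xs j → i ≡ j
lookup-injective (_ ∷ _)     zero    zero    _  = refl
lookup-injective (x∉xs ∷ _)  zero    (suc j) eq = contradiction eq (All.lookup x∉xs (∈-lookup j))
lookup-injective (x∉xs ∷ _)  (suc i) zero    eq = contradiction (sym eq) (All.lookup x∉xs (∈-lookup i))
lookup-injective (_ ∷ xs!)   (suc i) (suc j) eq = cong suc (lookup-injective xs! i j eq)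

-- Pigeonhole by deletion: take the witness of the head out of `S` and recurse. The witnesses of the
-- tail survive, since an index equal to the head's would have the same image under `f` and so give
-- an entry equal to the head, against uniqueness.
unique⇒length≤∣subset∣ : (f : Fin n → A) {xs : List A} → Unique xs → (S : Subset n) →
                         All (λ x → ∃ λ i → i ∈ S × f i ≡ x) xs → length xs ≤ ∣ S ∣
unique⇒length≤∣subset∣ f []           S []                     = z≤n
unique⇒length≤∣subset∣ f (x∉xs ∷ xs!) S ((i , i∈S , fi≡x) ∷ hs) =
  ≤-trans (s≤s (unique⇒length≤∣subset∣ f xs! (S - i) (All.zipWith avoid (x∉xs , hs))))
          (x∈p⇒∣p-x∣<∣p∣ i∈S)
  where
  avoid : ∀ {y} → _ ≢ y × (∃ λ j → j ∈ S × f j ≡ y) → ∃ λ j → j ∈ S - i × f j ≡ y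
  avoid (x≢y , j , j∈S , fj≡y) =
    j , x∈p∧x≢y⇒x∈p-y j∈S (λ { refl → x≢y (trans (sym fi≡x) fj≡y) }) , fj≡y

module _ {P : Pred (Fin n) p} (P? : Decidable P) where

  comprehension : Subset n
  comprehension = Vec.tabulate (does ∘ P?)

  ∈-comprehension⁺ : ∀ {i} → P i → i ∈ comprehension
  ∈-comprehension⁺ {i} pi =
    lookup⇒[]= i _ (trans (lookup∘tabulate (does ∘ P?) i) (dec-true (P? i) pi))

  ∈-comprehension⁻ : ∀ {i} → i ∈ comprehension → P i
  ∈-comprehension⁻ {i} i∈ with P? i | trans (sym (lookup∘tabulate (does ∘ P?) i)) ([]=⇒lookup i∈)
  -- In the `no` case the equation would read `false ≡ true`, so only the `yes` clause remains.
  ... | yes pi | _ = pi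

module _ (G : Graph) where
  open Graph G

  -- Any single vertex forms an independent set, because `_~_` is irreflexive.
  0<α : 0 < order → 0 < α G
  0<α 0<n = subst (_≤ α G) (∣⁅x⁆∣≡1 x) (∣independent∣≤α G independent)
    where
    x : Fin order
    x = fromℕ< 0<n

    independent : IsIndependent G ⁅ x ⁆
    independent u v u∈ v∈ = ~-irrefl (trans (x∈⁅y⁆⇒x≡y x u∈) (sym (x∈⁅y⁆⇒x≡y x v∈)))

  module _ (0<n : 0 < order) {V : Vector (Subset order) order} (coloring : IsColoring G V) where
    open IsColoring coloring

    -- `V` may list the empty class many times, so uniqueness has to come from the size condition of
    -- the filter: two sets that are equal and disjoint are empty, whereas a class of size `α G` is
    -- not.
    maximumClasses-unique : Unique (maximumClasses G V)
    maximumClasses-unique = unique (All.all-filter maximum? (tabulate V))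
      (AllPairs.filter⁺ maximum? (AllPairs.tabulate⁺ (disjoint _ _)))
      where
      maximum? = λ S → ∣ S ∣ ≟ⁿ α G

      distinct : ∀ {S T} → ∣ S ∣ ≡ α G → Empty (S ∩ T) → S ≢ T
      distinct {S} ∣S∣≡α S∩T=∅ refl = <-irrefl 0≡α (0<α 0<n)
        where
        0≡α = trans (sym (∣⊥∣≡0 order))
          (trans (cong ∣_∣ (sym (Empty-unique (subst Empty (∩-idem S) S∩T=∅)))) ∣S∣≡α)

      unique : ∀ {Ss} → All (λ S → ∣ S ∣ ≡ α G) Ss →
               AllPairs (λ S T → Empty (S ∩ T)) Ss → Unique Ss
      unique []            []       = []
      unique (∣S∣≡α ∷ eqs) (ds ∷ dss) = All.map (distinct ∣S∣≡α) ds ∷ unique eqs dss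

    maximumClasses≤α : length (maximumClasses G V) ≤ α (maximumIndependentSetGraph G)
    maximumClasses≤α =
      -- `classes` links the two counts: different maximum classes occupy different positions in it,
      -- and its independence bounds its size.
      ≤-trans (unique⇒length≤∣subset∣ set maximumClasses-unique classes (All.tabulate position))
              (∣independent∣≤α (maximumIndependentSetGraph G) independent)
      where
      set : Fin (length (maximumIndependentSets G)) → Subset order
      set = lookup (maximumIndependentSets G)

      isClass? : Decidable (λ u → ∃ λ k → V k ≡ set u)
      isClass? u = any? λ k → ≡-dec _≟ᵇ_ (V k) (set u)

      -- Each `set u` has size `α G` by construction, so only its occurrence in `V` is tested.
      classes : Subset (length (maximumIndependentSets G))
      classes = comprehension isClass?

      independent : IsIndependent (maximumIndependentSetGraph G) classes
      independent u v u∈ v∈ (u≢v , u∩v≠∅)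
        with k , Vk≡u ← ∈-comprehension⁻ isClass? u∈
           | l , Vl≡v ← ∈-comprehension⁻ isClass? v∈
        with k ≟ᶠ l
      -- One class at both positions: the list of maximum independent sets has no repeats, so `u`
      -- and `v` coincide, which adjacency excludes.
      ... | yes refl = u≢v (lookup-injective (maximumIndependentSets-unique G) u v
                             (trans (sym Vk≡u) Vl≡v))
      -- Different classes are disjoint, whereas adjacency supplies a common vertex.
      ... | no  k≢l  = disjoint k l k≢l
        (subst Nonempty (sym (cong₂ _∩_ Vk≡u Vl≡v)) u∩v≠∅)

      position : ∀ {S} → S ∈ˡ maximumClasses G V → ∃ λ u → u ∈ classes × set u ≡ S
      position S∈
        with S∈V , ∣S∣≡α ← ∈-filter⁻ (λ S → ∣ S ∣ ≟ⁿ α G) {xs = tabulate V} S∈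
        with k , refl ← ∈-tabulate⁻ S∈V =
        index S∈max , ∈-comprehension⁺ isClass? (k , lookup-index S∈max) , sym (lookup-index S∈max)
        -- A class is independent by properness, so size `α G` puts it in the list; its index there
        -- is the required position.
        where S∈max = ∈-maximumIndependentSets⁺ G (proper k , ∣S∣≡α)

theorem2 : (G : Graph) → 1 ≤ Graph.order G →
    (V : Vector (Subset (Graph.order G)) (Graph.order G)) →
    IsOptimalSumColoring G V →
    length (maximumClasses G V) ≤ α (maximumIndependentSetGraph G)
theorem2 G 1≤n V opt = maximumClasses≤α G 1≤n (IsOptimalSumColoring.isColoring opt)
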